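{- Let $G$ be a topological $2$-layer $3$-planar graph on $n$ vertices. Then $G$ has at most $2n-4$ edges for $n\ge 3$. Moreover, if $G$ is optimal (i.e. has exactly $2n-4$ edges), then $G$ is quasiplanar, that is, $G$ contains no three pairwise crossing edges.
   Context: All graphs are finite and simple (no loops or parallel edges). A topological $2$-layer graph is a bipartite graph $G=(U\,\dot\cup\,V,E)$, $E\subseteq U\times V$, drawn in the plane so that the vertices of $U$ and of $V$ are distinct points on two horizontal lines $L_u$ and $L_v$, respectively, and edges are $y$-monotone Jordan arcs; the drawing is assumed simple, i.e. adjacent edges do not cross and independent edges cross at most once. Denote the vertices by $u_1,\dots,u_p$ along $L_u$ and $v_1,\dots,v_q$ along $L_v$ in left-to-right order, $n=p+q$. (Thus edges $(u_i,v_x)$ and $(u_j,v_y)$ with $i<j$ cross if and only if $x>y$.) A topological $2$-layer graph is $k$-planar if each edge is crossed at most $k$ times, and quasiplanar ($3$-quasiplanar) if it contains no three pairwise crossing edges. -}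

module Defs where

open import Data.Nat.Base using (ℕ; _+_; _*_; _≤_)
open import Data.Fin.Base using (Fin; _<_; _>_)
open import Data.Fin.Properties using (_<?_)
open import Data.List.Base using (List; length; filter)
open import Data.List.Membership.Propositional using (_∈_)
open import Data.List.Relation.Unary.Unique.Propositional using (Unique)
open import Data.Product.Base using (_×_; _,_; ∃-syntax)
open import Data.Sum.Base using (_⊎_)
open import Relation.Binary.Core using (Rel)
open import Relation.Binary.Definitions using (Decidable)
open import Relation.Binary.PropositionalEquality using (_≡_)
open import Relation.Nullary.Decidable using (_×-dec_; _⊎-dec_)
open import Relation.Nullary.Negation using (¬_)

-- Indices give the left-to-right order of the vertices on each line; the edge
-- (i , x) joins u_i to v_x.
Edge : ℕ → ℕ → Set
Edge p q = Fin p × Fin q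

-- In a simple drawing with y-monotone edges, which pairs of edges cross is
-- determined by the two vertex orders (see Cross), so those orders and the edge
-- set carry all the information about the drawing that is used here.
record TwoLayerGraph (p q : ℕ) : Set where
  field
    edges  : List (Edge p q)
    unique : Unique edges

  order : ℕ
  order = p + q

  size : ℕ
  size = length edges

open TwoLayerGraph public

-- Two disjuncts because either edge may have the leftmost endpoint among the
-- u's.  Edges sharing an endpoint never cross.
Cross : ∀ {p q} → Rel (Edge p q) _
Cross (i , x) (j , y) = (i < j × x > y) ⊎ (j < i × y > x)

cross? : ∀ {p q} → Decidable (Cross {p} {q})
cross? (i , x) (j , y) = (i <? j ×-dec y <? x) ⊎-dec (j <? i ×-dec x <? y)

module _ {p q : ℕ} (G : TwoLayerGraph p q) where

  crossings : Edge p q → ℕ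
  crossings e = length (filter (cross? e) (edges G))

  KPlanar : ℕ → Set
  KPlanar k = ∀ e → e ∈ edges G → crossings e ≤ k

  Quasiplanar : Set
  Quasiplanar = ¬ (∃[ e ] ∃[ f ] ∃[ g ]
    (e ∈ edges G × f ∈ edges G × g ∈ edges G ×
     Cross e f × Cross e g × Cross f g))

  -- Exactly 2n - 4 edges, written additively to avoid truncated subtraction.
  Optimal : Set
  Optimal = size G + 4 ≡ 2 * order G

-- View the edge (i , x) as a grid point of rank i + x, so that crossing edges are
-- points in strictly decreasing position; for points in the box [l , h] the
-- bound 2n - 4 is 2 (rank h - rank l).  Points of equal rank cross pairwise.  So in a
-- quasiplanar graph each rank occurs at most twice, and the extreme ranks rank l
-- and rank h at most once.  If instead a ↘ b ↘ c is a decreasing chain, then each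
-- edge crosses a or c (at most 3 + 3 - 1 edges, as b crosses both) or lies in one of
-- the boxes [l , a ∧ c] and [a ∨ c , h], and rank (a ∨ c) ≥ rank (a ∧ c) + 4.
-- Induction on these boxes with the weaker bound 1 + 2 (rank h - rank l), which
-- also holds when l = h, gives a total strictly below 2 (rank h - rank l).
module Submission where

open import Defs
open import Data.Bool.Base using (true; false)
open import Data.Empty using (⊥)
open import Data.Fin.Base as Fin using (toℕ; fromℕ)
import Data.Fin.Properties as Fin
open import Data.List.Base using (List; []; _∷_; length; filter)
open import Data.List.Properties using (filter-all)
open import Data.List.Membership.Propositional using (_∈_)
open import Data.List.Membership.Propositional.Properties using (∈-filter⁺; ∈-filter⁻; ∈-length)
open import Data.List.Relation.Unary.All as All using ([]; _∷_)
open import Data.List.Relation.Unary.AllPairs using ([]; _∷_)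
open import Data.List.Relation.Unary.Any using (here; there)
open import Data.List.Relation.Unary.Unique.Propositional using (Unique)
import Data.List.Relation.Unary.Unique.Propositional.Properties as Unique
open import Data.List.Relation.Binary.Sublist.Propositional.Properties
  using (length-mono-≤; filter-⊆; filter⁺)
open import Data.Nat.Base using (ℕ; zero; suc; _+_; _*_; _≤_; _<_; z≤n; s≤s)
open import Data.Nat.Properties
open import Data.Nat.Tactic.RingSolver using (solve-∀)
open import Data.Product.Base using (_×_; _,_; proj₁; proj₂)
open import Data.Sum.Base using (_⊎_; inj₁; inj₂)
open import Relation.Binary.Core using (Rel)
open import Relation.Binary.Definitions as B using (tri<; tri≈; tri>)
open import Relation.Binary.PropositionalEquality
open import Relation.Nullary.Decidable using (does; yes; no; _×-dec_; decidable-stable)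
open import Relation.Nullary.Negation using (¬_; contradiction)
open import Relation.Unary using (Pred; Decidable)
open import Relation.Unary.Properties using (_∪?_; _∩?_; ∁?)

-- Counting in filtered lists.

module _ {a} {A : Set a} where

  length-filter-∪-∩ : ∀ {p q} {P : Pred A p} {Q : Pred A q}
    (P? : Decidable P) (Q? : Decidable Q) xs →
    length (filter (P? ∪? Q?) xs) + length (filter (P? ∩? Q?) xs) ≡
    length (filter P? xs) + length (filter Q? xs)
  length-filter-∪-∩ P? Q? [] = refl
  length-filter-∪-∩ P? Q? (x ∷ xs)
    with ih ← length-filter-∪-∩ P? Q? xs | does (P? x) | does (Q? x)
  ... | true  | true  = cong suc (trans (+-suc _ _) (trans (cong suc ih) (sym (+-suc _ _))))
  ... | true  | false = cong suc ih
  ... | false | true  = trans (cong suc ih) (sym (+-suc _ _))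
  ... | false | false = ih

  length-filter-∪ : ∀ {p q} {P : Pred A p} {Q : Pred A q}
    (P? : Decidable P) (Q? : Decidable Q) xs →
    length (filter (P? ∪? Q?) xs) ≤ length (filter P? xs) + length (filter Q? xs)
  length-filter-∪ P? Q? xs =
    ≤-trans (m≤m+n _ _) (≤-reflexive (length-filter-∪-∩ P? Q? xs))

  length-cover : ∀ {p q} {P : Pred A p} {Q : Pred A q}
    (P? : Decidable P) (Q? : Decidable Q) {xs} → (∀ {x} → x ∈ xs → P x ⊎ Q x) →
    length xs ≤ length (filter P? xs) + length (filter Q? xs)
  length-cover P? Q? {xs} cover =
    ≤-trans (≤-reflexive (sym (cong length (filter-all (P? ∪? Q?) (All.tabulate cover)))))
            (length-filter-∪ P? Q? xs)

  length-const≤1 : ∀ {y : A} {xs} → Unique xs → (∀ {x} → x ∈ xs → x ≡ y) → length xs ≤ 1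
  length-const≤1 {xs = []}        _                 const = z≤n
  length-const≤1 {xs = _ ∷ []}    _                 const = ≤-refl
  length-const≤1 {xs = _ ∷ _ ∷ _} ((x≢y ∷ _) ∷ _) const =
    contradiction (trans (const (here refl)) (sym (const (there (here refl))))) x≢y

  length≤2 : ∀ {xs : List A} → Unique xs →
    (∀ {x y z} → x ∈ xs → y ∈ xs → z ∈ xs → x ≢ y → x ≢ z → y ≢ z → ⊥) → length xs ≤ 2
  length≤2 {[]}            _ _ = z≤n
  length≤2 {_ ∷ []}        _ _ = s≤s z≤n
  length≤2 {_ ∷ _ ∷ []}    _ _ = ≤-refl
  length≤2 {_ ∷ _ ∷ _ ∷ _} ((x≢y ∷ x≢z ∷ _) ∷ (y≢z ∷ _) ∷ _) no3 =
    contradiction (no3 (here refl) (there (here refl)) (there (there (here refl))) x≢y x≢z y≢z) λ ()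

-- Edges as grid points: rank, order and crossing.

module _ {p q : ℕ} where

  infix 4 _≼_ _≼?_ _↘_

  rank : Edge p q → ℕ
  rank (i , x) = toℕ i + toℕ x

  _≼_ : Rel (Edge p q) _
  (i , x) ≼ (j , y) = i Fin.≤ j × x Fin.≤ y

  _≼?_ : B.Decidable _≼_
  (i , x) ≼? (j , y) = (i Fin.≤? j) ×-dec (x Fin.≤? y)

  -- Cross e f is, definitionally, (e ↘ f) ⊎ (f ↘ e).
  _↘_ : Rel (Edge p q) _
  (i , x) ↘ (j , y) = i Fin.< j × x Fin.> y

  ≼-rank⇒≡ : ∀ {e f} → e ≼ f → rank f ≤ rank e → e ≡ f
  ≼-rank⇒≡ {i , x} {j , y} (i≤j , x≤y) f≤e = cong₂ _,_
    (Fin.≤-antisym i≤j (+-cancelʳ-≤ (toℕ y) _ _ (≤-trans f≤e (+-monoʳ-≤ (toℕ i) x≤y))))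
    (Fin.≤-antisym x≤y (+-cancelˡ-≤ (toℕ j) _ _ (≤-trans f≤e (+-monoˡ-≤ (toℕ x) i≤j))))

  rank-mono : ∀ {e f} → e ≼ f → rank e ≤ rank f
  rank-mono (i≤j , x≤y) = +-mono-≤ i≤j x≤y

  -- With the coordinate sum fixed, a larger first coordinate forces a smaller second one.
  rank≡⇒cross : ∀ {e f : Edge p q} → rank e ≡ rank f → e ≢ f → Cross e f
  rank≡⇒cross {i , x} {j , y} eq e≢f with Fin.<-cmp i j
  ... | tri< i<j _ _ = inj₁ (i<j , ≰⇒> λ x≤y → <⇒≢ (+-mono-<-≤ i<j x≤y) eq)
  ... | tri≈ _ refl _ =
    contradiction (cong (i ,_) (Fin.toℕ-injective (+-cancelˡ-≡ (toℕ i) _ _ eq))) e≢f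
  ... | tri> _ _ j<i = inj₂ (j<i , ≰⇒> λ y≤x → <⇒≢ (+-mono-<-≤ j<i y≤x) (sym eq))

  -- a ∧ c and a ∨ c, for a ↘ c
  meet join : Edge p q → Edge p q → Edge p q
  meet (i , x) (k , z) = i , z
  join (i , x) (k , z) = k , x

  ↘-trans : ∀ {a b c} → a ↘ b → b ↘ c → a ↘ c
  ↘-trans (i<j , x>y) (j<k , y>z) = <-trans i<j j<k , <-trans y>z x>y

  -- The ranks differ by the sum of the two coordinate distances between `a` and `c`; each distance
  -- is at least 2 because `b` lies strictly between.
  rank-gap : ∀ {a b c} → a ↘ b → b ↘ c → 4 + rank (meet a c) ≤ rank (join a c)
  rank-gap {i , x} {_} {k , z} (i<j , x>y) (j<k , y>z) =
    ≤-trans (≤-reflexive (lemma (toℕ i) (toℕ z)))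
            (+-mono-≤ (≤-trans (s≤s i<j) j<k) (≤-trans (s≤s y>z) x>y))
    where
    lemma : ∀ m n → 4 + (m + n) ≡ (2 + m) + (2 + n)
    lemma = solve-∀

  -- An edge crossing neither `a` nor `c` is comparable to both. As `a ↘ c`, it cannot be above one
  -- and below the other, so it is below both or above both.
  chain-cover : ∀ {a c} → a ↘ c → ∀ e →
    (e ≼ meet a c ⊎ join a c ≼ e) ⊎ (Cross a e ⊎ Cross c e)
  chain-cover {a₁ , a₂} {c₁ , c₂} (a₁<c₁ , c₂<a₂) (i , x)
    with i Fin.≤? a₁ | x Fin.≤? c₂ | c₁ Fin.≤? i | a₂ Fin.≤? x
  ... | yes i≤a₁ | yes x≤c₂ | _        | _        = inj₁ (inj₁ (i≤a₁ , x≤c₂))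
  ... | yes i≤a₁ | no  x≰c₂ | _        | _        =
    inj₂ (inj₂ (inj₂ (≤-<-trans i≤a₁ a₁<c₁ , ≰⇒> x≰c₂)))
  ... | no  i≰a₁ | _        | _        | no  a₂≰x = inj₂ (inj₁ (inj₁ (≰⇒> i≰a₁ , ≰⇒> a₂≰x)))
  ... | no  _    | _        | yes c₁≤i | yes a₂≤x = inj₁ (inj₂ (c₁≤i , a₂≤x))
  ... | no  _    | _        | no  c₁≰i | yes a₂≤x =
    inj₂ (inj₂ (inj₂ (≰⇒> c₁≰i , <-≤-trans c₂<a₂ a₂≤x)))

  -- Subgraphs, and counting quasiplanar graphs rank by rank.

  infixl 5 _↾_

  -- Only edges are deleted and `p`, `q` stay fixed, so bounds for subgraphs are stated through
  -- boxes rather than through `order`.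
  _↾_ : ∀ {ℓ} {P : Pred (Edge p q) ℓ} → TwoLayerGraph p q → Decidable P → TwoLayerGraph p q
  G ↾ P? = record
    { edges  = filter P? (edges G)
    ; unique = Unique.filter⁺ P? (unique G)
    }

  _⊑[_,_] : TwoLayerGraph p q → Edge p q → Edge p q → Set
  G ⊑[ l , h ] = ∀ {e} → e ∈ edges G → l ≼ e × e ≼ h

  module _ {ℓ} {P : Pred (Edge p q) ℓ} (P? : Decidable P) (G : TwoLayerGraph p q) where

    ↾-∈⁻ : ∀ {e} → e ∈ edges (G ↾ P?) → e ∈ edges G × P e
    ↾-∈⁻ = ∈-filter⁻ P?

    ↾-kplanar : ∀ {k} → KPlanar G k → KPlanar (G ↾ P?) k
    ↾-kplanar kp e e∈ = ≤-trans
      (length-mono-≤ (filter⁺ (cross? e) (cross? e) (λ { refl x → x }) (filter-⊆ P? (edges G))))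
      (kp e (proj₁ (↾-∈⁻ e∈)))

    ↾-quasiplanar : Quasiplanar G → Quasiplanar (G ↾ P?)
    ↾-quasiplanar qp (e , f , g , e∈ , f∈ , g∈ , cs) =
      qp (e , f , g , proj₁ (↾-∈⁻ e∈) , proj₁ (↾-∈⁻ f∈) , proj₁ (↾-∈⁻ g∈) , cs)

  -- Three edges of equal rank would cross pairwise, and `rank l` is attained by `l` alone. The
  -- upper limit is a rank rather than a corner, so that the induction can peel off the top rank.
  quasiplanar-ranks : ∀ {l} m (G : TwoLayerGraph p q) → Quasiplanar G →
    (∀ {e} → e ∈ edges G → l ≼ e × rank e ≤ rank l + m) → size G ≤ 1 + 2 * m
  quasiplanar-ranks {l} zero G qp within = length-const≤1 (unique G) λ {e} e∈ →
    let l≼e , e≤l = within e∈ in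
    sym (≼-rank⇒≡ l≼e (subst (rank e ≤_) (+-identityʳ (rank l)) e≤l))
  quasiplanar-ranks {l} (suc m) G qp within = begin
    size G                              ≤⟨ length-cover low? top? split ⟩
    size (G ↾ low?) + size (G ↾ top?)   ≤⟨ +-mono-≤ low≤ top≤ ⟩
    1 + 2 * m + 2                       ≡⟨ lemma m ⟩
    1 + 2 * suc m                       ∎
    where
    open ≤-Reasoning
    lemma : ∀ m → 1 + 2 * m + 2 ≡ 1 + 2 * suc m
    lemma = solve-∀
    low? : Decidable (λ e → rank e ≤ rank l + m)
    low? e = rank e ≤? rank l + m
    top? : Decidable (λ e → rank e ≡ rank l + suc m)
    top? e = rank e ≟ rank l + suc m
    split : ∀ {e} → e ∈ edges G → rank e ≤ rank l + m ⊎ rank e ≡ rank l + suc m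
    split {e} e∈ with low? e
    ... | yes low = inj₁ low
    ... | no ¬low = inj₂ (≤-antisym (proj₂ (within e∈))
                                    (subst (_≤ rank e) (sym (+-suc (rank l) m)) (≰⇒> ¬low)))
    low≤ : size (G ↾ low?) ≤ 1 + 2 * m
    low≤ = quasiplanar-ranks m (G ↾ low?) (↾-quasiplanar low? G qp) λ e∈ →
      let e∈G , low = ↾-∈⁻ low? G e∈ in proj₁ (within e∈G) , low
    top≤ : size (G ↾ top?) ≤ 2
    top≤ = length≤2 (unique (G ↾ top?)) λ {e} {f} {g} e∈ f∈ g∈ e≢f e≢g f≢g →
      let e∈G , re = ↾-∈⁻ top? G e∈
          f∈G , rf = ↾-∈⁻ top? G f∈
          g∈G , rg = ↾-∈⁻ top? G g∈
      in qp (e , f , g , e∈G , f∈G , g∈G ,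
             rank≡⇒cross (trans re (sym rf)) e≢f ,
             rank≡⇒cross (trans re (sym rg)) e≢g ,
             rank≡⇒cross (trans rf (sym rg)) f≢g)

  -- The top rank is attained by `h` alone, which saves one edge over `quasiplanar-ranks`; the
  -- successor keeps top and bottom rank distinct.
  quasiplanar-bound : ∀ {l h} m (G : TwoLayerGraph p q) → Quasiplanar G → G ⊑[ l , h ] →
    rank h ≡ rank l + suc m → size G ≤ 2 * suc m
  quasiplanar-bound {l} {h} m G qp within h≡ = begin
    size G                                 ≤⟨ length-cover low? (∁? low?) split ⟩
    size (G ↾ low?) + size (G ↾ ∁? low?)   ≤⟨ +-mono-≤ low≤ top≤ ⟩
    1 + 2 * m + 1                          ≡⟨ lemma m ⟩
    2 * suc m                              ∎
    where
    open ≤-Reasoning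
    lemma : ∀ m → 1 + 2 * m + 1 ≡ 2 * suc m
    lemma = solve-∀
    low? : Decidable (λ e → rank e ≤ rank l + m)
    low? e = rank e ≤? rank l + m
    split : ∀ {e} → e ∈ edges G → rank e ≤ rank l + m ⊎ ¬ (rank e ≤ rank l + m)
    split {e} _ with low? e
    ... | yes low = inj₁ low
    ... | no ¬low = inj₂ ¬low
    low≤ : size (G ↾ low?) ≤ 1 + 2 * m
    low≤ = quasiplanar-ranks m (G ↾ low?) (↾-quasiplanar low? G qp) λ e∈ →
      let e∈G , low = ↾-∈⁻ low? G e∈ in proj₁ (within e∈G) , low
    top≤ : size (G ↾ ∁? low?) ≤ 1
    top≤ = length-const≤1 (unique (G ↾ ∁? low?)) λ {e} e∈ →
      let e∈G , ¬low = ↾-∈⁻ (∁? low?) G e∈ in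
      ≼-rank⇒≡ (proj₂ (within e∈G))
        (subst (_≤ rank e) (sym (trans h≡ (+-suc (rank l) m))) (≰⇒> ¬low))

  -- Decreasing chains and the induction on boxes.

  record Chain (G : TwoLayerGraph p q) : Set where
    constructor chain
    field
      {a b c} : Edge p q
      a∈ : a ∈ edges G
      b∈ : b ∈ edges G
      c∈ : c ∈ edges G
      a↘b : a ↘ b
      b↘c : b ↘ c

  -- Orienting each crossing by `↘` always yields two consecutive steps; the clauses with a wildcard
  -- also absorb the cyclic orientations.
  ¬chain⇒quasiplanar : ∀ G → ¬ Chain G → Quasiplanar G
  ¬chain⇒quasiplanar G ¬ch (e , f , g , e∈ , f∈ , g∈ , cs) = ¬ch (sort cs)
    where
    sort : Cross e f × Cross e g × Cross f g → Chain G
    sort (inj₁ ef , _       , inj₁ fg) = chain e∈ f∈ g∈ ef fg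
    sort (inj₁ ef , inj₁ eg , inj₂ gf) = chain e∈ g∈ f∈ eg gf
    sort (inj₁ ef , inj₂ ge , inj₂ gf) = chain g∈ e∈ f∈ ge ef
    sort (inj₂ fe , inj₁ eg , _      ) = chain f∈ e∈ g∈ fe eg
    sort (inj₂ fe , inj₂ ge , inj₁ fg) = chain f∈ g∈ e∈ fg ge
    sort (inj₂ fe , inj₂ ge , inj₂ gf) = chain g∈ f∈ e∈ gf fe

  module _ (G : TwoLayerGraph p q) (kp : KPlanar G 3) (ch : Chain G) where
    open Chain ch

    private
      below? : Decidable (_≼ meet a c)
      below? = _≼? meet a c

      above? : Decidable (join a c ≼_)
      above? = join a c ≼?_

    chain-crossings : size (G ↾ (cross? a ∪? cross? c)) ≤ 5
    chain-crossings = +-cancelʳ-≤ 1 _ _ (begin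
      size (G ↾ (cross? a ∪? cross? c)) + 1
        -- `b` witnesses that the intersection is nonempty.
        ≤⟨ +-monoʳ-≤ _ (∈-length (∈-filter⁺ (cross? a ∩? cross? c) b∈ (inj₁ a↘b , inj₂ b↘c))) ⟩
      size (G ↾ (cross? a ∪? cross? c)) + size (G ↾ (cross? a ∩? cross? c))
        ≡⟨ length-filter-∪-∩ (cross? a) (cross? c) (edges G) ⟩
      crossings G a + crossings G c
        ≤⟨ +-mono-≤ (kp a a∈) (kp c c∈) ⟩
      6 ∎)
      where open ≤-Reasoning

    chain-size : size G ≤ size (G ↾ below?) + size (G ↾ above?) + 5
    chain-size = begin
      size G
        ≤⟨ length-cover (below? ∪? above?) (cross? a ∪? cross? c) {edges G}
             (λ _ → chain-cover (↘-trans a↘b b↘c) _) ⟩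
      size (G ↾ (below? ∪? above?)) + size (G ↾ (cross? a ∪? cross? c))
        ≤⟨ +-mono-≤ (length-filter-∪ below? above? (edges G)) chain-crossings ⟩
      size (G ↾ below?) + size (G ↾ above?) + 5 ∎
      where open ≤-Reasoning

  -- `n` is the induction measure, a strict bound on the rank width of the box. Subtraction is
  -- avoided by moving `2 * rank l` to the left.
  WeakBound : ℕ → Set
  WeakBound n = ∀ {l h} (G : TwoLayerGraph p q) → KPlanar G 3 → l ≼ h → G ⊑[ l , h ] →
    rank h < rank l + n → size G + 2 * rank l ≤ 1 + 2 * rank h

  -- The 5 crossing edges and the slack 1 of each sub-box cost 7, while the rank gap of 4 between
  -- the sub-boxes gains 8; hence strictness.
  chain-bound : ∀ {n l h} (G : TwoLayerGraph p q) → WeakBound n → KPlanar G 3 → G ⊑[ l , h ] →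
    rank h < rank l + suc n → Chain G → size G + 2 * rank l < 2 * rank h
  chain-bound {n} {l} {h} G weak kp within h<l+1+n ch =
    +-cancelʳ-≤ (2 * rank j) _ _ (begin
      suc (size G + 2 * rank l) + 2 * rank j
        ≤⟨ +-monoˡ-≤ (2 * rank j) (s≤s (+-monoˡ-≤ (2 * rank l) (chain-size G kp ch))) ⟩
      suc (#L + #R + 5 + 2 * rank l) + 2 * rank j
        ≡⟨ lemma₁ #L #R (rank l) (rank j) ⟩
      (#L + 2 * rank l) + (#R + 2 * rank j) + 6
        ≤⟨ +-monoˡ-≤ 6 (+-mono-≤ lower upper) ⟩
      (1 + 2 * rank m) + (1 + 2 * rank h) + 6
        ≡⟨ lemma₂ (rank m) (rank h) ⟩
      2 * rank h + 2 * (4 + rank m)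
        ≤⟨ +-monoʳ-≤ (2 * rank h) (*-monoʳ-≤ 2 gap) ⟩
      2 * rank h + 2 * rank j ∎)
    where
    open ≤-Reasoning
    open Chain ch
    m j : Edge p q
    m = meet a c
    j = join a c
    #L #R : ℕ
    #L = size (G ↾ (_≼? m))
    #R = size (G ↾ (j ≼?_))
    gap : 4 + rank m ≤ rank j
    gap = rank-gap a↘b b↘c
    m<j : rank m < rank j
    m<j = ≤-trans (s≤s (m≤n+m (rank m) 3)) gap
    -- `m` takes one coordinate from `a` and the other from `c`, so each half comes from a different
    -- edge; likewise for `j`.
    l≼m : l ≼ m
    l≼m = proj₁ (proj₁ (within a∈)) , proj₂ (proj₁ (within c∈))
    j≼h : j ≼ h
    j≼h = proj₁ (proj₂ (within c∈)) , proj₂ (proj₂ (within a∈))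
    h≤l+n : rank h ≤ rank l + n
    h≤l+n = ≤-pred (subst (rank h <_) (+-suc (rank l) n) h<l+1+n)
    -- Both sub-boxes are narrower than the box from `l` to `h`: here `rank m < rank h`, and for
    -- `upper` `rank l < rank j`.
    lower : #L + 2 * rank l ≤ 1 + 2 * rank m
    lower = weak (G ↾ (_≼? m)) (↾-kplanar (_≼? m) G kp) l≼m
      (λ e∈ → let e∈G , e≼m = ↾-∈⁻ (_≼? m) G e∈ in proj₁ (within e∈G) , e≼m)
      (<-≤-trans m<j (≤-trans (rank-mono j≼h) h≤l+n))
    upper : #R + 2 * rank j ≤ 1 + 2 * rank h
    upper = weak (G ↾ (j ≼?_)) (↾-kplanar (j ≼?_) G kp) j≼h
      (λ e∈ → let e∈G , j≼e = ↾-∈⁻ (j ≼?_) G e∈ in j≼e , proj₂ (within e∈G))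
      (≤-<-trans h≤l+n (+-monoˡ-< n (≤-<-trans (rank-mono l≼m) m<j)))
    lemma₁ : ∀ x y r s → suc (x + y + 5 + 2 * r) + 2 * s ≡ (x + 2 * r) + (y + 2 * s) + 6
    lemma₁ = solve-∀
    lemma₂ : ∀ r s → (1 + 2 * r) + (1 + 2 * s) + 6 ≡ 2 * s + 2 * (4 + r)
    lemma₂ = solve-∀

  weak-bound : ∀ n → WeakBound n
  weak-bound zero {l} {h} G kp l≼h within h<l+0 =
    contradiction (rank-mono l≼h) (<⇒≱ (subst (rank h <_) (+-identityʳ (rank l)) h<l+0))
  weak-bound (suc n) {l} {h} G kp l≼h within h<l+1+n =
    -- The bound is decidable, so it may be assumed to fail. Any chain would prove it, so there is
    -- none, and the quasiplanar case applies. This avoids searching for a chain.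
    decidable-stable (_ ≤? _) λ ¬bound → ¬bound (quasiplanar-case (¬chain⇒quasiplanar G λ ch →
      ¬bound (≤-trans (<⇒≤ (chain-bound G (weak-bound n) kp within h<l+1+n ch)) (n≤1+n _))))
    where
    quasiplanar-case : Quasiplanar G → size G + 2 * rank l ≤ 1 + 2 * rank h
    quasiplanar-case qp with m≤n⇒∃[o]m+o≡n (rank-mono l≼h)
    ... | o , l+o≡h = begin
      size G + 2 * rank l
        ≤⟨ +-monoˡ-≤ _ (quasiplanar-ranks o G qp λ {e} e∈ → let l≼e , e≼h = within e∈ in
             l≼e , subst (rank e ≤_) (sym l+o≡h) (rank-mono e≼h)) ⟩
      1 + 2 * o + 2 * rank l  ≡⟨ lemma o (rank l) ⟩
      1 + 2 * (rank l + o)    ≡⟨ cong (λ r → 1 + 2 * r) l+o≡h ⟩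
      1 + 2 * rank h          ∎
      where
      open ≤-Reasoning
      lemma : ∀ o r → 1 + 2 * o + 2 * r ≡ 1 + 2 * (r + o)
      lemma = solve-∀

module _ {p q : ℕ} where

  bottom top : Edge (suc p) (suc q)
  bottom = Fin.zero , Fin.zero
  top    = fromℕ p , fromℕ q

  -- Indices start at 0, so this rank is n - 2, and twice it is 2n - 4.
  rank-top : rank top ≡ p + q
  rank-top = cong₂ _+_ (Fin.toℕ-fromℕ p) (Fin.toℕ-fromℕ q)

  ⊑-whole : (G : TwoLayerGraph (suc p) (suc q)) → G ⊑[ bottom , top ]
  ⊑-whole G {i , x} _ = (z≤n , z≤n) , (Fin.≤fromℕ i , Fin.≤fromℕ x)

  2*order : (G : TwoLayerGraph (suc p) (suc q)) → 2 * order G ≡ 2 * (p + q) + 4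
  2*order _ = lemma p q
    where
    lemma : ∀ p q → 2 * (suc p + suc q) ≡ 2 * (p + q) + 4
    lemma = solve-∀

  chain-strict : (G : TwoLayerGraph (suc p) (suc q)) → KPlanar G 3 → Chain G →
    size G + 4 < 2 * order G
  chain-strict G kp ch = subst (size G + 4 <_) (sym (2*order G)) (+-monoˡ-< 4 (begin-strict
    size G                      ≡⟨ +-identityʳ (size G) ⟨
    -- `rank bottom` is 0, so with `n = rank top` the width condition is
    -- `rank top < suc (rank top)`.
    size G + 2 * rank bottom    <⟨ chain-bound G (weak-bound (rank top)) kp (⊑-whole G) ≤-refl ch ⟩
    2 * rank top                ≡⟨ cong (2 *_) rank-top ⟩
    2 * (p + q)                 ∎))
    where open ≤-Reasoning

  quasiplanar-size : (G : TwoLayerGraph (suc p) (suc q)) → Quasiplanar G → 3 ≤ order G →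
    size G + 4 ≤ 2 * order G
  quasiplanar-size G qp (s≤s n≥3)
    -- n ≥ 3 gives `p + q` ≥ 1, so `bottom` and `top` have different ranks.
    with m≤n⇒∃[o]m+o≡n (≤-pred (subst (2 ≤_) (+-suc p q) n≥3))
  ... | m , 1+m≡p+q = subst (size G + 4 ≤_) (sym (2*order G)) (+-monoˡ-≤ 4
    (subst (λ r → size G ≤ 2 * r) 1+m≡p+q
      (quasiplanar-bound m G qp (⊑-whole G) (trans rank-top (sym 1+m≡p+q)))))

edgeless : ∀ {p q} (G : TwoLayerGraph p q) → (∀ {e} → ¬ (e ∈ edges G)) → 3 ≤ order G →
  size G + 4 ≤ 2 * order G
edgeless G none n≥3 with edges G
-- 4 ≤ 2 * 3 ≤ 2 * n.
... | []    = ≤-trans (s≤s (s≤s (s≤s (s≤s z≤n)))) (*-monoʳ-≤ 2 n≥3)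
... | _ ∷ _ = contradiction (here refl) none

theorem4 : ∀ (p q : ℕ) (G : TwoLayerGraph p q) → KPlanar G 3 →
    (3 ≤ order G → size G + 4 ≤ 2 * order G) × (Optimal G → Quasiplanar G)
theorem4 zero    q       G kp = edgeless G (λ { {() , _} }) , λ { _ ((() , _) , _) }
theorem4 (suc p) zero    G kp = edgeless G (λ { {_ , ()} }) , λ { _ ((_ , ()) , _) }
theorem4 (suc p) (suc q) G kp =
  (λ n≥3 → decidable-stable (_ ≤? _) λ ¬bound → ¬bound (quasiplanar-size G
    (¬chain⇒quasiplanar G λ ch → ¬bound (<⇒≤ (chain-strict G kp ch))) n≥3)) ,
  -- A chain makes the bound strict, which optimality rules out.
  λ optimal → ¬chain⇒quasiplanar G λ ch → <⇒≢ (chain-strict G kp ch) optimal
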